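{- Let $G$ and $H$ be finite simple graphs. If the Cartesian product $G \,\Box\, H$ is connected and well-dominated, then $G$ or $H$ is a complete graph.
   Context: All graphs are finite and simple (undirected, no loops, no multiple edges), with nonempty vertex set. For a graph $X$ and $S \subseteq V(X)$, the closed neighborhood $N[S]$ is $S$ together with all vertices adjacent to some vertex of $S$. A dominating set of $X$ is a set $S \subseteq V(X)$ with $N[S] = V(X)$; it is minimal if $S - \{x\}$ does not dominate $X$ for every $x \in S$. The domination number $\gamma(X)$ is the cardinality of a smallest dominating set of $X$. The graph $X$ is well-dominated if all of its minimal dominating sets have the same cardinality, namely $\gamma(X)$. The Cartesian product $X \,\Box\, Y$ has vertex set $V(X) \times V(Y)$, and two vertices $(x_1,y_1)$ and $(x_2,y_2)$ are adjacent if they are equal in one coordinate and adjacent in the other coordinate. The one-vertex graph $K_1$ counts as a complete graph. -}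

module Defs where

open import Data.Fin.Base using (Fin)
open import Data.Fin.Properties using (*↔×) renaming (_≟_ to _≟ᶠ_)
open import Data.Fin.Subset using (Subset; ∣_∣; _-_) renaming (_∈_ to _∈ᶠ_)
open import Data.Nat.Base using (ℕ; _*_; _≤_)
open import Data.Product.Base using (_×_; _,_; ∃-syntax; Σ-syntax)
open import Data.Product.Function.NonDependent.Propositional using (_×-↔_)
open import Data.Sum.Base using (_⊎_; inj₁; inj₂)
open import Function.Bundles using (_↔_; Inverse)
open import Function.Construct.Composition using (_↔-∘_)
open import Function.Construct.Symmetry using (↔-sym)
open import Function.Properties.Inverse using (↔⇒↣)
open import Level using (0ℓ)
open import Relation.Binary.Core using (Rel)
open import Relation.Binary.Construct.Closure.ReflexiveTransitive using (Star)
open import Relation.Binary.Definitions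
  using (Decidable; DecidableEquality; Irreflexive; Symmetric)
open import Relation.Binary.PropositionalEquality using (_≡_; _≢_; refl; sym)
open import Relation.Nullary using (¬_)
open import Relation.Nullary.Decidable using (via-injection; _×-dec_; _⊎-dec_)

-- Adjacency is decidable, so that the classical content of a finite graph is
-- available constructively.  The field `vertex` makes the vertex set nonempty.
record Graph : Set₁ where
  infix 4 _~_
  field
    V        : Set
    order    : ℕ
    finite   : V ↔ Fin order
    vertex   : V
    _~_      : Rel V 0ℓ
    _~?_     : Decidable _~_
    ~-sym    : Symmetric _~_
    ~-irrefl : Irreflexive _≡_ _~_

  index : V → Fin order
  index = Inverse.to finite

  _≟_ : DecidableEquality V
  _≟_ = via-injection (↔⇒↣ finite) _≟ᶠ_

-- A set of vertices is a `Subset` of the indices of the vertices, so that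
-- cardinality is the library's `∣_∣`.
module _ (X : Graph) where
  open Graph X

  VertexSet : Set
  VertexSet = Subset order

  infix 4 _∈_
  _∈_ : V → VertexSet → Set
  v ∈ S = index v ∈ᶠ S

  remove : VertexSet → V → VertexSet
  remove S x = S - index x

  N[_] : VertexSet → V → Set
  N[ S ] v = v ∈ S ⊎ (∃[ u ] u ∈ S × u ~ v)

  Dominating : VertexSet → Set
  Dominating S = ∀ v → N[ S ] v

  MinimalDominating : VertexSet → Set
  MinimalDominating S = Dominating S × (∀ x → x ∈ S → ¬ Dominating (remove S x))

  -- γ(X) = k, as a relation
  IsDominationNumber : ℕ → Set
  IsDominationNumber k =
    (Σ[ S ∈ VertexSet ] Dominating S × ∣ S ∣ ≡ k) ×
    (∀ S → Dominating S → k ≤ ∣ S ∣)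

  WellDominated : Set
  WellDominated =
    ∃[ γ ] IsDominationNumber γ × (∀ S → MinimalDominating S → ∣ S ∣ ≡ γ)

  Connected : Set
  Connected = ∀ u v → Star _~_ u v

  Complete : Set
  Complete = ∀ u v → u ≢ v → u ~ v

infixr 7 _□_
_□_ : Graph → Graph → Graph
G □ H = record
  { V        = G.V × H.V
  ; order    = G.order * H.order
  ; finite   = ↔-sym *↔× ↔-∘ (G.finite ×-↔ H.finite)
  ; vertex   = G.vertex , H.vertex
  ; _~_      = λ (x₁ , y₁) (x₂ , y₂) → (x₁ ≡ x₂ × y₁ H.~ y₂) ⊎ (x₁ G.~ x₂ × y₁ ≡ y₂)
  ; _~?_     = λ (x₁ , y₁) (x₂ , y₂) →
                 ((x₁ G.≟ x₂) ×-dec (y₁ H.~? y₂)) ⊎-dec ((x₁ G.~? x₂) ×-dec (y₁ H.≟ y₂))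
  ; ~-sym    = λ { (inj₁ (p , q)) → inj₁ (sym p , H.~-sym q)
                 ; (inj₂ (p , q)) → inj₂ (G.~-sym p , sym q) }
  ; ~-irrefl = λ { refl (inj₁ (_ , q)) → H.~-irrefl refl q
                 ; refl (inj₂ (p , _)) → G.~-irrefl refl p }
  }
  where
  module G = Graph G
  module H = Graph H

{-# OPTIONS --safe #-}
-- Write n(X) for the order of X and epn(d) for the external private neighbours of d with
-- respect to D.  Assume neither factor is complete and, by symmetry, Δ(G) ≤ Δ(H).  Let D be
-- a dominating set of G in which every d has epn(d) ≠ ∅; then D × V(H) is a minimal
-- dominating set of G □ H, so no dominating set has fewer than |D| n(H) elements.
--
-- If some epn(d) is independent, take an induced path a – c – b in H.  Replace D by
-- (D − d) ∪ epn(d) over a and b; then some copies of d over neighbours of a and b become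
-- superfluous.  Let F be a minimal dominating set obtained this way, and let F_a, F_b be the
-- dominating sets that differ from D × V(H) only around a and only around b.  Since c is
-- adjacent to both, |F_a| + |F_b| < |F| + |D| n(H), which contradicts minimality.
--
-- Otherwise every maximal independent set S of G − D has |S| ≤ |D|, since exchanging one
-- copy of D for S yields a minimal dominating set.  Let h have degree Δ(H), and suppose
-- epn(d) can be properly coloured by the neighbours of h with one neighbour unused.
-- Putting over each used colour a maximal independent set containing its colour class
-- allows (d , h) to be omitted, which contradicts |D| n(H) being minimum.  As
-- |epn(d)| ≤ Δ(G) ≤ Δ(H), such a colouring exists unless epn(d) = N(d) is a clique of
-- Δ(G) vertices, and then the connected graph G is the clique N[d].
module Submission where

open import Defs
open import Data.Bool.Base using (Bool; true; false; if_then_else_)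
open import Data.Empty using (⊥; ⊥-elim)
open import Data.Fin.Base using (Fin; zero; suc; combine; remQuot; punchIn; _↑ˡ_; _↑ʳ_)
open import Data.Fin.Properties using (any?; punchInᵢ≢i; remQuot-combine)
open import Data.Fin.Subset using (Subset; ∣_∣; _-_; _∉_)
open import Data.Fin.Subset.Properties using (p─q⊆p)
open import Data.Nat.Base using (ℕ; zero; suc; _+_; _*_; _∸_; _≤_; _<_; z≤n; s≤s)
open import Data.Nat.Induction using (<-wellFounded)
open import Data.Nat.Properties hiding (_≟_)
open import Algebra.Properties.CommutativeMonoid.Sum +-0-commutativeMonoid
  using (sum; sum-cong-≗; sum-remove; sum-replicate-zero; ∑-comm; ∑-distrib-+)
open import Data.Product.Base using (_×_; _,_; ∃-syntax; ∃; proj₁; proj₂; swap)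
open import Data.Unit.Base using (⊤)
open import Data.Sum.Base using (_⊎_; inj₁; inj₂)
open import Data.Vec.Base using (tabulate; lookup; _∷_; here; there)
open import Data.Vec.Properties using (lookup∘tabulate; []=⇒lookup; lookup⇒[]=)
open import Function.Base using (_∘_; case_of_)
open import Function.Bundles using (Inverse)
open import Induction.WellFounded using (Acc; acc)
open import Relation.Binary.Construct.Closure.ReflexiveTransitive using (Star; ε; _◅_)
open import Relation.Binary.PropositionalEquality
open import Relation.Binary.Definitions using () renaming (Decidable to Decidable₂)
open import Relation.Nullary
open import Relation.Nullary.Decidable
open import Relation.Unary using (Decidable)

open Graph using (V)

-- Minimal elements and finite sums

-- `P` need not be decidable, so a minimiser of `μ` cannot be computed. In a proof of `⊥` one may
-- still be assumed: any element with a smaller value restarts the descent.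
least : ∀ {a p} {A : Set a} {P : A → Set p} (μ : A → ℕ) {a₀} → P a₀ →
        (∀ {a} → P a → (∀ {b} → P b → μ a ≤ μ b) → ⊥) → ⊥
least {P = P} μ p₀ k = go (<-wellFounded _) p₀
  where
  go : ∀ {a} → Acc _<_ (μ a) → P a → ⊥
  go (acc rs) p = k p λ pb → ≮⇒≥ λ b<a → go (rs b<a) pb

indicator : ∀ {p} {P : Set p} → Dec P → ℕ
indicator P? = if does P? then 1 else 0

indicator-mono : ∀ {p q} {P : Set p} {Q : Set q} (P? : Dec P) (Q? : Dec Q) → (P → Q) →
                 indicator P? ≤ indicator Q?
indicator-mono (no _)  _       _   = z≤n
indicator-mono (yes _) (yes _) _   = ≤-refl
indicator-mono (yes p) (no ¬q) p⇒q = contradiction (p⇒q p) ¬q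

sum-mono-≤ : ∀ {n} {f g : Fin n → ℕ} → (∀ i → f i ≤ g i) → sum f ≤ sum g
sum-mono-≤ {zero}  f≤g = z≤n
sum-mono-≤ {suc n} f≤g = +-mono-≤ (f≤g zero) (sum-mono-≤ (f≤g ∘ suc))

sum-mono-< : ∀ {n} {f g : Fin n → ℕ} → (∀ i → f i ≤ g i) → ∀ i → f i < g i →
             sum f < sum g
sum-mono-< f≤g zero    f<g = +-mono-<-≤ f<g (sum-mono-≤ (f≤g ∘ suc))
sum-mono-< f≤g (suc i) f<g = +-mono-≤-< (f≤g zero) (sum-mono-< (f≤g ∘ suc) i f<g)

sum-combine : ∀ m n (f : Fin (m * n) → ℕ) →
              sum f ≡ sum {m} (λ i → sum {n} (λ j → f (combine i j)))
sum-combine zero    n f = refl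
sum-combine (suc m) n f = trans (sum-↑ n f) 
  (cong (sum (λ j → f (j ↑ˡ (m * n))) +_) (sum-combine m n (f ∘ (n ↑ʳ_))))
  where
  sum-↑ : ∀ n {k} (f : Fin (n + k) → ℕ) →
          sum f ≡ sum (f ∘ (_↑ˡ k)) + sum (f ∘ (n ↑ʳ_))
  sum-↑ zero    f = refl
  sum-↑ (suc n) f = trans (cong (f zero +_) (sum-↑ n (f ∘ suc))) (sym (+-assoc (f zero) _ _))

sum-remQuot : ∀ m n (f : Fin m × Fin n → ℕ) →
              sum (λ k → f (remQuot {m} n k)) ≡
              sum {m} (λ i → sum {n} (λ j → f (i , j)))
sum-remQuot m n f = trans (sum-combine m n (λ k → f (remQuot {m} n k)))
  (sum-cong-≗ {m} λ i → sum-cong-≗ {n} λ j → cong f (remQuot-combine {m} {n} i j))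

sum-indicator-remove : ∀ {n p q} {P : Fin n → Set p} {Q : Fin n → Set q}
  (P? : Decidable P) (Q? : Decidable Q) (i : Fin n) → P i → ¬ Q i →
  (∀ j → j ≢ i → P j → Q j) → (∀ j → Q j → P j) →
  sum (λ j → indicator (P? j)) ≡ suc (sum (λ j → indicator (Q? j)))
sum-indicator-remove {suc n} P? Q? i Pi ¬Qi P⇒Q Q⇒P = begin
  sum f                                ≡⟨ sum-remove f ⟩
  f i + sum (λ j → f (punchIn i j))    ≡⟨ cong₂ _+_ fi≡1 (sum-cong-≗ f≗g) ⟩
  suc (sum (λ j → g (punchIn i j)))    ≡⟨ cong (λ x → suc (x + sum (λ j → g (punchIn i j)))) (sym gi≡0) ⟩
  suc (g i + sum (λ j → g (punchIn i j))) ≡⟨ cong suc (sum-remove g) ⟨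
  suc (sum g)                          ∎
  where
  open ≡-Reasoning
  f g : Fin (suc n) → ℕ
  f j = indicator (P? j)
  g j = indicator (Q? j)
  fi≡1 : f i ≡ 1
  fi≡1 with P? i
  ... | yes _  = refl
  ... | no ¬Pi = contradiction Pi ¬Pi
  gi≡0 : g i ≡ 0
  gi≡0 with Q? i
  ... | yes Qi = contradiction Qi ¬Qi
  ... | no _   = refl
  f≗g : ∀ j → f (punchIn i j) ≡ g (punchIn i j)
  f≗g j = ≤-antisym (indicator-mono (P? _) (Q? _) (P⇒Q _ (punchInᵢ≢i i j)))
                    (indicator-mono (Q? _) (P? _) (Q⇒P _))

-- Counting the vertices with a decidable property

module _ (X : Graph) where
  open Graph X hiding (V)
  open Inverse finite using (to; from; strictlyInverseˡ; strictlyInverseʳ)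

  ∃? : ∀ {p} {P : V X → Set p} → Decidable P → Dec (∃ P)
  ∃? {P = P} P? = map′ (λ (i , p) → from i , p)
                       (λ (v , p) → to v , subst P (sym (strictlyInverseʳ v)) p)
                       (any? (P? ∘ from))

  sumOver : (V X → ℕ) → ℕ
  sumOver f = sum (f ∘ from)

  sumOver-mono-≤ : {f g : V X → ℕ} → (∀ v → f v ≤ g v) → sumOver f ≤ sumOver g
  sumOver-mono-≤ f≤g = sum-mono-≤ (f≤g ∘ from)

  sumOver-mono-< : {f g : V X → ℕ} → (∀ v → f v ≤ g v) → ∀ v → f v < g v →
                   sumOver f < sumOver g
  sumOver-mono-< {f} {g} f≤g v f<g =
    sum-mono-< (f≤g ∘ from) (to v) (subst (λ u → f u < g u) (sym (strictlyInverseʳ v)) f<g)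

  -- Opaque, so that P? can be recovered from # P? by unification.
  opaque
    # : ∀ {p} {P : V X → Set p} → Decidable P → ℕ
    # P? = sumOver (λ v → indicator (P? v))

    #-def : ∀ {p} {P : V X → Set p} (P? : Decidable P) → # P? ≡ sumOver (λ v → indicator (P? v))
    #-def P? = refl

  module _ {p q} {P : V X → Set p} {Q : V X → Set q} (P? : Decidable P) (Q? : Decidable Q) where

    #-mono : (∀ v → P v → Q v) → # P? ≤ # Q?
    #-mono P⇒Q = subst₂ _≤_ (sym (#-def P?)) (sym (#-def Q?))
      (sumOver-mono-≤ λ v → indicator-mono (P? v) (Q? v) (P⇒Q v))

    #-remove : ∀ v → P v → ¬ Q v → (∀ u → u ≢ v → P u → Q u) → (∀ u → Q u → P u) →
               # P? ≡ suc (# Q?)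
    #-remove v Pv ¬Qv P⇒Q Q⇒P = subst₂ (λ m n → m ≡ suc n) (sym (#-def P?)) (sym (#-def Q?))
     (sum-indicator-remove (P? ∘ from) (Q? ∘ from) (to v)
      (subst P (sym (strictlyInverseʳ v)) Pv) (¬Qv ∘ subst Q (strictlyInverseʳ v))
      (λ i i≢v → P⇒Q _ λ eq → i≢v (trans (sym (strictlyInverseˡ i)) (cong to eq))) (λ i → Q⇒P _))

  _∖?_ : ∀ {p} {P : V X → Set p} → Decidable P → ∀ v → Decidable (λ u → P u × u ≢ v)
  (P? ∖? v) u = P? u ×-dec ¬? (u ≟ v)

  #-∖ : ∀ {p} {P : V X → Set p} (P? : Decidable P) {v} → P v → # P? ≡ suc (# (P? ∖? v))
  #-∖ P? {v} Pv = #-remove P? (P? ∖? v) v Pv (λ (_ , v≢v) → v≢v refl) (λ u u≢v Pu → Pu , u≢v) (λ u → proj₁)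

  #-mono-< : ∀ {p q} {P : V X → Set p} {Q : V X → Set q} (P? : Decidable P) (Q? : Decidable Q) →
             (∀ v → P v → Q v) → ∀ {v} → ¬ P v → Q v → # P? < # Q?
  #-mono-< {P = P} P? Q? P⇒Q {v} ¬Pv Qv = subst (# P? <_) (sym (#-∖ Q? Qv))
    (s≤s (#-mono P? (Q? ∖? v) λ u Pu → P⇒Q u Pu , λ u≡v → ¬Pv (subst P u≡v Pu)))

  #>0⇒∃ : ∀ {p} {P : V X → Set p} (P? : Decidable P) → 0 < # P? → ∃ P
  #>0⇒∃ P? 0<#P with ∃? P?
  ... | yes x  = x
  ... | no ¬∃P = contradiction (≤-trans 0<#P #P≤0) λ ()
    where
    outside : ∀ v → indicator (P? v) ≤ 0
    outside v with P? v
    ... | yes p = contradiction (v , p) ¬∃P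
    ... | no _  = ≤-refl
    #P≤0 : # P? ≤ 0
    #P≤0 = begin
      # P?                               ≡⟨ #-def P? ⟩
      sumOver (λ v → indicator (P? v))   ≤⟨ sumOver-mono-≤ outside ⟩
      sum {order} (λ _ → 0)              ≡⟨ sum-replicate-zero order ⟩
      0                                  ∎
      where open ≤-Reasoning

-- Comparing cardinalities

-- In use, the elements of `P` receive distinct colours from `Q`, and `missed` is a spare colour.
-- Outside `P` the function is arbitrary.
record StrictInjection (X Y : Graph) (P : V X → Set) (Q : V Y → Set) : Set where
  field
    fun       : V X → V Y
    into      : ∀ {x} → P x → Q (fun x)
    injective : ∀ {x x′} → P x → P x′ → fun x ≡ fun x′ → x ≡ x′
    missed    : V Y
    missed∈   : Q missed
    misses    : ∀ {x} → P x → fun x ≢ missed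

module _ (X Y : Graph) where
  private
    module X = Graph X

  -- Pairing off one element from each side preserves the strict inequality; once `P` is exhausted,
  -- `Q` still has an element, and this is the missed one.
  strictInjection : {P : V X → Set} {Q : V Y → Set} (P? : Decidable P) (Q? : Decidable Q) →
                    # X P? < # Y Q? → StrictInjection X Y P Q
  strictInjection P? Q? = go _ P? Q? refl
    where
    go : ∀ k {P : V X → Set} {Q : V Y → Set} (P? : Decidable P) (Q? : Decidable Q) →
         # X P? ≡ k → k < # Y Q? → StrictInjection X Y P Q
    go zero {P} P? Q? #P≡0 0<#Q = record
      { fun       = λ _ → b
      ; into      = λ Px → ⊥-elim (empty Px)
      ; injective = λ Px → ⊥-elim (empty Px)
      ; missed    = b
      ; missed∈   = Qb
      ; misses    = λ Px → ⊥-elim (empty Px)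
      }
      where
      ∃Q = #>0⇒∃ Y Q? 0<#Q
      b = proj₁ ∃Q
      Qb = proj₂ ∃Q
      empty : ∀ {x} → ¬ P x
      empty Px = case trans (sym #P≡0) (#-∖ X P? Px) of λ ()
    go (suc k) {P} {Q} P? Q? #P≡ k<#Q = record
      { fun       = fun
      ; into      = into
      ; injective = injective
      ; missed    = I.missed
      ; missed∈   = proj₁ I.missed∈
      ; misses    = misses
      }
      where
      ∃P = #>0⇒∃ X P? (subst (0 <_) (sym #P≡) (s≤s z≤n))
      ∃Q = #>0⇒∃ Y Q? (≤-trans (s≤s z≤n) k<#Q)
      a = proj₁ ∃P
      b = proj₁ ∃Q
      P∖a? = _∖?_ X P? a
      Q∖b? = _∖?_ Y Q? b
      module I = StrictInjection (go k P∖a? Q∖b?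
        (suc-injective (trans (sym (#-∖ X P? (proj₂ ∃P))) #P≡))
        (≤-pred (subst (suc k <_) (#-∖ Y Q? (proj₂ ∃Q)) k<#Q)))
      fun : V X → V Y
      fun x with x X.≟ a
      ... | yes _ = b
      ... | no _  = I.fun x
      into : ∀ {x} → P x → Q (fun x)
      into {x} Px with x X.≟ a
      ... | yes _  = proj₂ ∃Q
      ... | no x≢a = proj₁ (I.into (Px , x≢a))
      injective : ∀ {x x′} → P x → P x′ → fun x ≡ fun x′ → x ≡ x′
      injective {x} {x′} Px Px′ eq with x X.≟ a | x′ X.≟ a
      ... | yes refl | yes refl = refl
      ... | yes _    | no x′≢a  = contradiction (sym eq) (proj₂ (I.into (Px′ , x′≢a)))
      ... | no x≢a   | yes _    = contradiction eq (proj₂ (I.into (Px , x≢a)))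
      ... | no x≢a   | no x′≢a  = I.injective (Px , x≢a) (Px′ , x′≢a) eq
      misses : ∀ {x} → P x → fun x ≢ I.missed
      misses {x} Px eq with x X.≟ a
      ... | yes _  = proj₂ I.missed∈ (sym eq)
      ... | no x≢a = I.misses (Px , x≢a) eq

-- Dominating sets of a Cartesian product

x∉p-x : ∀ {n} (p : Subset n) x → x ∉ p - x
x∉p-x (_ ∷ p) zero    ()
x∉p-x (_ ∷ p) (suc x) (there x∈) = x∉p-x p x x∈

∣tabulate∣ : ∀ {n} (b : Fin n → Bool) → ∣ tabulate b ∣ ≡ sum (λ i → if b i then 1 else 0)
∣tabulate∣ {zero}  b = refl
∣tabulate∣ {suc n} b with b zero
... | true  = cong suc (∣tabulate∣ (b ∘ suc))
... | false = ∣tabulate∣ (b ∘ suc)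

module _ (X : Graph) {P : V X → Set} (P? : Decidable P) where
  open Graph X using (finite; index)
  open Inverse finite using (from; strictlyInverseʳ)

  toSubset : VertexSet X
  toSubset = tabulate (does ∘ P? ∘ from)

  ∣toSubset∣ : ∣ toSubset ∣ ≡ # X P?
  ∣toSubset∣ = trans (∣tabulate∣ (does ∘ P? ∘ from)) (sym (#-def X P?))

  private
    lookup-toSubset : ∀ v → lookup toSubset (index v) ≡ does (P? v)
    lookup-toSubset v = trans (lookup∘tabulate _ (index v)) (cong (does ∘ P?) (strictlyInverseʳ v))

  ∈-toSubset⁺ : ∀ {v} → P v → _∈_ X v toSubset
  ∈-toSubset⁺ {v} Pv = lookup⇒[]= _ _ (trans (lookup-toSubset v) (dec-true (P? v) Pv))

  ∈-toSubset⁻ : ∀ {v} → _∈_ X v toSubset → P v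
  ∈-toSubset⁻ {v} v∈ with P? v | trans (sym ([]=⇒lookup v∈)) (lookup-toSubset v)
  ... | yes Pv | _ = Pv
  ... | no _   | ()

module _ (G H : Graph) where
  private
    module G = Graph G
    module H = Graph H

  -- Counted layer by layer over H, so that two sets can be compared within each copy of G.
  ## : {F : V G → V H → Set} → Decidable₂ F → ℕ
  ## F? = sumOver H λ h → # G λ g → F? g h

  ##-def : {F : V G → V H → Set} (F? : Decidable₂ F) →
           ## F? ≡ sumOver H λ h → sumOver G λ g → indicator (F? g h)
  ##-def F? = sum-cong-≗ λ j → #-def G λ g → F? g (Inverse.from H.finite j)

  Without : (V G → V H → Set) → V G → V H → V G → V H → Set
  Without F g h g′ h′ = F g′ h′ × ¬ (g′ ≡ g × h′ ≡ h)

  Dominates : (V G → V H → Set) → Set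
  Dominates F = ∀ g h → F g h ⊎ (∃[ g′ ] F g′ h × g′ G.~ g) ⊎ (∃[ h′ ] F g h′ × h′ H.~ h)

  Irredundant : (V G → V H → Set) → Set
  Irredundant F = ∀ g h → F g h → ¬ Dominates (Without F g h)

  -- The form in which well-domination enters the argument. Sets are relations between the factors,
  -- so that exchanging the factors only flips arguments.
  MinimalIsMinimum : Set₁
  MinimalIsMinimum = ∀ {F F′ : V G → V H → Set} (F? : Decidable₂ F) (F′? : Decidable₂ F′) →
    Dominates F → Irredundant F → Dominates F′ → ## F? ≤ ## F′?

  uncurried? : {F : V G → V H → Set} → Decidable₂ F → Decidable λ ((g , h) : V (G □ H)) → F g h
  uncurried? F? (g , h) = F? g h

  #-□ : {F : V G → V H → Set} (F? : Decidable₂ F) → # (G □ H) (uncurried? F?) ≡ ## F?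
  #-□ F? = begin
    # (G □ H) (uncurried? F?)
      ≡⟨ #-def (G □ H) (uncurried? F?) ⟩
    sum (λ k → f (remQuot {G.order} H.order k))
      ≡⟨ sum-remQuot G.order H.order f ⟩
    sum (λ i → sum λ j → f (i , j))
      ≡⟨ ∑-comm {G.order} {H.order} _ ⟩
    sum (λ j → sum λ i → f (i , j))
      ≡⟨ ##-def F? ⟨
    ## F? ∎
    where
    open ≡-Reasoning
    open Inverse using (from)
    f : Fin G.order × Fin H.order → ℕ
    f (i , j) = indicator (F? (from G.finite i) (from H.finite j))

  module _ {F : V G → V H → Set} (F? : Decidable₂ F) where
    vertexSet : VertexSet (G □ H)
    vertexSet = toSubset (G □ H) (uncurried? F?)

    ∣vertexSet∣ : ∣ vertexSet ∣ ≡ ## F?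
    ∣vertexSet∣ = trans (∣toSubset∣ (G □ H) (uncurried? F?)) (#-□ F?)

    ∈-vertexSet⁺ : ∀ {g h} → F g h → _∈_ (G □ H) (g , h) vertexSet
    ∈-vertexSet⁺ = ∈-toSubset⁺ (G □ H) (uncurried? F?)

    ∈-vertexSet⁻ : ∀ {g h} → _∈_ (G □ H) (g , h) vertexSet → F g h
    ∈-vertexSet⁻ = ∈-toSubset⁻ (G □ H) (uncurried? F?)

    dominating : Dominates F → Dominating (G □ H) vertexSet
    dominating dom (g , h) with dom g h
    ... | inj₁ f = inj₁ (∈-vertexSet⁺ f)
    ... | inj₂ (inj₁ (g′ , f , e)) = inj₂ ((g′ , h) , ∈-vertexSet⁺ f , inj₂ (e , refl))
    ... | inj₂ (inj₂ (h′ , f , e)) = inj₂ ((g , h′) , ∈-vertexSet⁺ f , inj₁ (refl , e))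

    minimalDominating : Dominates F → Irredundant F → MinimalDominating (G □ H) vertexSet
    minimalDominating dom irr = dominating dom , λ (g , h) gh∈ dom′ →
      irr g h (∈-vertexSet⁻ gh∈) λ g′ h′ → case dom′ (g′ , h′) of λ
        { (inj₁ u∈) → inj₁ (remaining u∈)
        ; (inj₂ ((g″ , _) , u∈ , inj₂ (e , refl))) → inj₂ (inj₁ (g″ , remaining u∈ , e))
        ; (inj₂ ((_ , h″) , u∈ , inj₁ (refl , e))) → inj₂ (inj₂ (h″ , remaining u∈ , e))
        }
      where
      remaining : ∀ {g h g′ h′} → _∈_ (G □ H) (g′ , h′) (remove (G □ H) vertexSet (g , h)) →
                  Without F g h g′ h′
      remaining u∈ = ∈-vertexSet⁻ (p─q⊆p vertexSet _ u∈) ,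
        λ { (refl , refl) → x∉p-x vertexSet _ u∈ }

  wellDominated⇒minimalIsMinimum : WellDominated (G □ H) → MinimalIsMinimum
  wellDominated⇒minimalIsMinimum (γ , (_ , γ≤) , ≡γ) F? F′? dom irr dom′ = begin
    ## F?             ≡⟨ ∣vertexSet∣ F? ⟨
    ∣ vertexSet F? ∣  ≡⟨ ≡γ (vertexSet F?) (minimalDominating F? dom irr) ⟩
    γ                 ≤⟨ γ≤ (vertexSet F′?) (dominating F′? dom′) ⟩
    ∣ vertexSet F′? ∣ ≡⟨ ∣vertexSet∣ F′? ⟩
    ## F′?            ∎
    where open ≤-Reasoning

  ##-mono-< : ∀ {F F′} (F? : Decidable₂ F) (F′? : Decidable₂ F′) → (∀ g h → F g h → F′ g h) →
              ∀ {g h} → ¬ F g h → F′ g h → ## F? < ## F′?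
  ##-mono-< F? F′? F⊆F′ {h = h} ¬f f′ = sumOver-mono-< H
    (λ h → #-mono G (λ g → F? g h) (λ g → F′? g h) (λ g → F⊆F′ g h)) h
    (#-mono-< G (λ g → F? g h) (λ g → F′? g h) (λ g → F⊆F′ g h) ¬f f′)

  without? : ∀ {F} → Decidable₂ F → ∀ g h → Decidable₂ (Without F g h)
  without? F? g h g′ h′ = F? g′ h′ ×-dec ¬? (g′ G.≟ g ×-dec h′ H.≟ h)

  -- A dominating subset of `F` with fewest elements is irredundant, since omitting a redundant pair
  -- would give a smaller one.
  minimalSubset : ∀ {F} → Decidable₂ F → Dominates F →
    (∀ {F′} → Decidable₂ F′ → (∀ g h → F′ g h → F g h) → Dominates F′ → Irredundant F′ → ⊥) → ⊥
  minimalSubset {F} F? dom k = least {A = ∃ Decidable₂}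
    {P = λ (F′ , _) → (∀ g h → F′ g h → F g h) × Dominates F′} (λ (_ , F′?) → ## F′?)
    {F , F?} ((λ _ _ f → f) , dom)
    λ { {F′ , F′?} (F′⊆F , dom′) minimum → k F′? F′⊆F dom′ λ g h f dom″ →
        <⇒≱ (##-mono-< (without? F′? g h) F′? (λ _ _ → proj₁) (λ (_ , ne) → ne (refl , refl)) f)
            (minimum {_ , without? F′? g h} ((λ g′ h′ f′ → F′⊆F g′ h′ (proj₁ f′)) , dom″)) }

MinimalIsMinimum-sym : ∀ G H → MinimalIsMinimum G H → MinimalIsMinimum H G
MinimalIsMinimum-sym G H min F? F′? dom irr dom′ = subst₂ _≤_ (##-flip F?) (##-flip F′?)
  (min (λ g h → F? h g) (λ g h → F′? h g) (flip-dominates dom)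
       (λ g h f dom″ → irr h g f λ h′ g′ → case dom″ g′ h′ of λ
         { (inj₁ (f , ne)) → inj₁ (f , ne ∘ swap)
         ; (inj₂ (inj₁ (x , (f , ne) , e))) → inj₂ (inj₂ (x , (f , ne ∘ swap) , e))
         ; (inj₂ (inj₂ (x , (f , ne) , e))) → inj₂ (inj₁ (x , (f , ne ∘ swap) , e)) })
       (flip-dominates dom′))
  where
  ##-flip : ∀ {F : V H → V G → Set} (F? : Decidable₂ F) → ## G H (λ g h → F? h g) ≡ ## H G F?
  ##-flip F? = trans (##-def G H (λ g h → F? h g))
    (trans (∑-comm {Graph.order H} {Graph.order G} _) (sym (##-def H G F?)))
  flip-dominates : ∀ {F} → Dominates H G F → Dominates G H (λ g h → F h g)
  flip-dominates dom g h with dom h g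
  ... | inj₁ f        = inj₁ f
  ... | inj₂ (inj₁ x) = inj₂ (inj₂ x)
  ... | inj₂ (inj₂ x) = inj₂ (inj₁ x)

-- External private neighbours

module _ (X : Graph) where
  open Graph X hiding (V)

  Private : (V X → Set) → V X → V X → Set
  Private D d v = ¬ D v × d ~ v × ¬ (∃[ u ] (D u × u ≢ d) × u ~ v)

  PrivateIndependent : (V X → Set) → V X → Set
  PrivateIndependent D d = ∀ p q → Private D d p → Private D d q → ¬ p ~ q

  record PrivatelyDominating (D : V X → Set) : Set where
    field
      member?   : Decidable D
      dominates : ∀ v → D v ⊎ (∃[ u ] D u × u ~ v)
      private-neighbour : ∀ d → D d → ∃ (Private D d)

    shared? : ∀ d v → Dec (∃[ u ] (D u × u ≢ d) × u ~ v)
    shared? d v = ∃? X λ u → (member? u ×-dec ¬? (u ≟ d)) ×-dec (u ~? v)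

    private? : ∀ d → Decidable (Private D d)
    private? d v = ¬? (member? v) ×-dec (d ~? v) ×-dec ¬? (shared? d v)

    private⊎shared : ∀ d {v} → ¬ D v → Private D d v ⊎ (∃[ u ] (D u × u ≢ d) × u ~ v)
    private⊎shared d {v} v∉D with dominates v | shared? d v
    ... | _                   | yes s = inj₂ s
    ... | inj₁ v∈D            | no _  = contradiction v∈D v∉D
    ... | inj₂ (u , u∈D , u~v) | no ¬s with u ≟ d
    ...   | yes refl = inj₁ (v∉D , u~v , ¬s)
    ...   | no u≢d   = contradiction (u , (u∈D , u≢d) , u~v) ¬s

    private-unique : ∀ {d v u} → Private D d v → D u → u ~ v → u ≡ d
    private-unique {d} {v} {u} (_ , _ , ¬s) u∈D u~v with u ≟ d
    ... | yes u≡d = u≡d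
    ... | no u≢d  = contradiction (u , (u∈D , u≢d) , u~v) ¬s

  -- Bollobás–Cockayne: among the minimum dominating sets, take one spanning the fewest
  -- isolated vertices.  A member d without an external private neighbour is isolated in D,
  -- and replacing it by any of its neighbours yields a set with fewer isolated vertices.
  privatelyDominating : (∀ v → ∃[ u ] u ~ v) → (∀ {D} → PrivatelyDominating D → ⊥) → ⊥
  privatelyDominating neighbour k =
    least {A = ∃ Decidable} {P = λ (D , _) → Dom D} (λ (_ , D?) → # X D?)
      {(λ _ → ⊤) , λ _ → yes _} (λ _ → inj₁ _)
      λ { {D₁ , D₁?} dom₁ min₁ →
    least {A = ∃ Decidable} {P = λ (D , D?) → Dom D × # X D? ≤ # X D₁?}
      (λ (_ , D?) → # X (isolated? D?)) {D₁ , D₁?} (dom₁ , ≤-refl)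
      λ { {D , D?} (dom , #D≤) min → k record
        { member? = D? ; dominates = dom
        ; private-neighbour = has-private D? dom
            (λ D′? dom′ → ≤-trans #D≤ (min₁ {_ , D′?} dom′))
            (λ D′? dom′ #D′≤ → min {_ , D′?} (dom′ , ≤-trans #D′≤ #D≤)) } } }
    where
    Dom : (V X → Set) → Set
    Dom D = ∀ v → D v ⊎ (∃[ u ] D u × u ~ v)

    Isolated : (V X → Set) → V X → Set
    Isolated D v = D v × ¬ (∃[ u ] D u × u ~ v)

    isolated? : ∀ {D} → Decidable D → Decidable (Isolated D)
    isolated? D? v = D? v ×-dec ¬? (∃? X λ u → D? u ×-dec (u ~? v))

    module _ {D} (D? : Decidable D) (dom : Dom D)
      (minimum : ∀ {D′} (D′? : Decidable D′) → Dom D′ → # X D? ≤ # X D′?)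
      (fewest-isolated : ∀ {D′} (D′? : Decidable D′) → Dom D′ → # X D′? ≤ # X D? →
                         # X (isolated? D?) ≤ # X (isolated? D′?)) where

      module _ {d} (d∈D : D d) (¬private : ¬ ∃ (Private D d)) where

        shared : ∀ {v} → v ≢ d → (D v × v ≢ d) ⊎ (∃[ u ] (D u × u ≢ d) × u ~ v)
        shared {v} v≢d with D? v | dom v
        ... | yes v∈D | _ = inj₁ (v∈D , v≢d)
        ... | no v∉D | inj₁ v∈D = contradiction v∈D v∉D
        ... | no v∉D | inj₂ (u , u∈D , u~v) with u ≟ d
        ...   | no u≢d = inj₂ (u , (u∈D , u≢d) , u~v)
        ...   | yes refl = inj₂ (decidable-stable
                  (∃? X λ u → (D? u ×-dec ¬? (u ≟ d)) ×-dec (u ~? v))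
                  λ ¬s → ¬private (v , v∉D , u~v , ¬s))

        -- Otherwise D - d would dominate, d through x and every other vertex by `shared`, although
        -- D has minimum size.
        d-isolated : ¬ (∃[ u ] D u × u ~ d)
        d-isolated (x , x∈D , x~d) = <⇒≱ (≤-reflexive (sym (#-∖ X D? d∈D)))
          (minimum (_∖?_ X D? d) λ v → case v ≟ d of λ
            { (yes refl) → inj₂ (x , (x∈D , λ x≡d → ~-irrefl x≡d x~d) , x~d)
            ; (no v≢d) → shared v≢d })

        g  = proj₁ (neighbour d)
        g~d = proj₂ (neighbour d)
        d≢g : d ≢ g
        d≢g d≡g = ~-irrefl (sym d≡g) g~d

        Swapped : V X → Set
        Swapped v = (D v × v ≢ d) ⊎ v ≡ g

        swapped? : Decidable Swapped
        swapped? v = (D? v ×-dec ¬? (v ≟ d)) ⊎-dec (v ≟ g)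

        swapped-dom : Dom Swapped
        swapped-dom v with v ≟ d
        ... | yes refl = inj₂ (g , inj₂ refl , g~d)
        ... | no v≢d with shared v≢d
        ...   | inj₁ v∈            = inj₁ (inj₁ v∈)
        ...   | inj₂ (u , u∈ , u~v) = inj₂ (u , inj₁ u∈ , u~v)

        #swapped≤ : # X swapped? ≤ # X D?
        #swapped≤ = subst₂ _≤_ (sym (#-∖ X swapped? (inj₂ refl))) (sym (#-∖ X D? d∈D))
          (s≤s (#-mono X (_∖?_ X swapped? g) (_∖?_ X D? d) λ
            { v (inj₁ v∈ , _) → v∈ ; v (inj₂ v≡g , v≢g) → contradiction v≡g v≢g }))

        fewer : # X (isolated? swapped?) < # X (isolated? D?)
        fewer = #-mono-< X (isolated? swapped?) (isolated? D?) isolated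
                  (λ { (inj₁ (_ , d≢d) , _) → d≢d refl ; (inj₂ d≡g , _) → d≢g d≡g })
                  (d∈D , d-isolated)
          where
          isolated : ∀ v → Isolated Swapped v → Isolated D v
          -- The new member g is not isolated: it lies outside D because d is isolated in D, and as
          -- it is not private to d, some other member of D is adjacent to it.
          isolated v (inj₂ refl , ¬nbr) with shared (d≢g ∘ sym)
          ... | inj₁ (g∈D , _)      = contradiction (g , g∈D , g~d) d-isolated
          ... | inj₂ (u , u∈ , u~g) = contradiction (u , inj₁ u∈ , u~g) ¬nbr
          isolated v (inj₁ (v∈D , v≢d) , ¬nbr) = v∈D , λ (u , u∈D , u~v) → case u ≟ d of λ
            { (yes refl) → d-isolated (v , v∈D , ~-sym u~v)
            ; (no u≢d) → ¬nbr (u , inj₁ (u∈D , u≢d) , u~v) }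

      has-private : ∀ d → D d → ∃ (Private D d)
      has-private d d∈D = decidable-stable
        (∃? X λ v → ¬? (D? v) ×-dec (d ~? v) ×-dec
                    ¬? (∃? X λ u → (D? u ×-dec ¬? (u ≟ d)) ×-dec (u ~? v)))
        λ ¬private → <⇒≱ (fewer d∈D ¬private)
          (fewest-isolated (swapped? d∈D ¬private) (swapped-dom d∈D ¬private) (#swapped≤ d∈D ¬private))

-- Independent private neighbours against induced paths

module _ (G H : Graph) (minimum : MinimalIsMinimum G H)
  {D : V G → Set} (good : PrivatelyDominating G D) where
  private
    module G = Graph G
    module H = Graph H
  open PrivatelyDominating good

  Everywhere : V G → V H → Set
  Everywhere g h = D g

  everywhere? : Decidable₂ Everywhere
  everywhere? g h = member? g

  everywhere-dominates : Dominates G H Everywhere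
  everywhere-dominates g h with dominates g
  ... | inj₁ g∈D = inj₁ g∈D
  ... | inj₂ x   = inj₂ (inj₁ x)

  -- A private neighbour p of d is outside D, so no other layer dominates (p , h), and within the
  -- layer only d does.
  everywhere-irredundant : Irredundant G H Everywhere
  everywhere-irredundant d h d∈D dom with private-neighbour d d∈D
  ... | p , pr with dom p h
  ...   | inj₁ (p∈D , _) = proj₁ pr p∈D
  ...   | inj₂ (inj₁ (u , (u∈D , ne) , u~p)) = ne (private-unique pr u∈D u~p , refl)
  ...   | inj₂ (inj₂ (_ , (p∈D , _) , _)) = proj₁ pr p∈D

  module InducedPath {a b c} (a~c : a H.~ c) (b~c : b H.~ c) (a≢b : a ≢ b) (a≁b : ¬ a H.~ b)
    {d} (d∈D : D d) (indep : PrivateIndependent G D d) where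

    End : V H → Set
    End h = h ≡ a ⊎ h ≡ b

    end? : Decidable End
    end? h = (h H.≟ a) ⊎-dec (h H.≟ b)

    ThirdNeighbour : Set
    ThirdNeighbour = ∃[ x ] x H.~ c × ¬ End x

    third? : Dec ThirdNeighbour
    third? = ∃? H λ x → (x H.~? c) ×-dec ¬? (end? x)

    end≁ : ∀ {x y} → End x → End y → ¬ x H.~ y
    end≁ (inj₁ refl) (inj₁ refl) = H.~-irrefl refl
    end≁ (inj₁ refl) (inj₂ refl) = a≁b
    end≁ (inj₂ refl) (inj₁ refl) = a≁b ∘ H.~-sym
    end≁ (inj₂ refl) (inj₂ refl) = H.~-irrefl refl

    c-not-end : ¬ End c
    c-not-end (inj₁ refl) = H.~-irrefl refl a~c
    c-not-end (inj₂ refl) = H.~-irrefl refl b~c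

    -- The copy of d over c is dispensable as soon as c has a neighbour other than a and b.
    Start : V G → V H → Set
    Start g h = (End h × ((D g × g ≢ d) ⊎ Private G D d g)) ⊎
                (¬ End h × D g × ¬ (g ≡ d × h ≡ c × ThirdNeighbour))

    start? : Decidable₂ Start
    start? g h = (end? h ×-dec ((member? g ×-dec ¬? (g G.≟ d)) ⊎-dec private? d g)) ⊎-dec
                 (¬? (end? h) ×-dec member? g ×-dec ¬? ((g G.≟ d) ×-dec (h H.≟ c) ×-dec third?))

    e : V G
    e = proj₁ (private-neighbour d d∈D)

    e-private : Private G D d e
    e-private = proj₂ (private-neighbour d d∈D)

    start-dominates : Dominates G H Start
    start-dominates g h with end? h
    start-dominates g h | yes h-end with g G.≟ d | member? g
    ... | yes refl | _ = inj₂ (inj₁ (e , inj₁ (h-end , inj₂ e-private) , G.~-sym (proj₁ (proj₂ e-private))))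
    ... | no g≢d | yes g∈D = inj₁ (inj₁ (h-end , inj₁ (g∈D , g≢d)))
    ... | no g≢d | no g∉D with private⊎shared d g∉D
    ...   | inj₁ pr = inj₁ (inj₁ (h-end , inj₂ pr))
    ...   | inj₂ (u , u∈ , u~g) = inj₂ (inj₁ (u , inj₁ (h-end , inj₁ u∈) , u~g))
    start-dominates g h | no ¬end with h H.≟ c | third?
    ... | no h≢c | _ = case dominates g of λ
      { (inj₁ g∈D) → inj₁ (inj₂ (¬end , g∈D , λ (_ , h≡c , _) → h≢c h≡c))
      ; (inj₂ (u , u∈D , u~g)) → inj₂ (inj₁ (u , inj₂ (¬end , u∈D , λ (_ , h≡c , _) → h≢c h≡c) , u~g)) }
    ... | _ | no ¬t = case dominates g of λ
      { (inj₁ g∈D) → inj₁ (inj₂ (¬end , g∈D , λ (_ , _ , t) → ¬t t))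
      ; (inj₂ (u , u∈D , u~g)) → inj₂ (inj₁ (u , inj₂ (¬end , u∈D , λ (_ , _ , t) → ¬t t) , u~g)) }
    -- With d omitted over c, the copy of d over x dominates (d , c), and the private neighbours of
    -- d over c are dominated by their copies over a.
    ... | yes refl | yes (x , x~c , ¬endx) with g G.≟ d | member? g
    ...   | yes refl | _ = inj₂ (inj₂ (x , inj₂ (¬endx , d∈D , λ (_ , x≡c , _) → H.~-irrefl x≡c x~c) , x~c))
    ...   | no g≢d | yes g∈D = inj₁ (inj₂ (¬end , g∈D , λ (g≡d , _) → g≢d g≡d))
    ...   | no g≢d | no g∉D with private⊎shared d g∉D
    ...     | inj₁ pr = inj₂ (inj₂ (a , inj₁ (inj₁ refl , inj₂ pr) , a~c))
    ...     | inj₂ (u , (u∈D , u≢d) , u~g) = inj₂ (inj₁ (u , inj₂ (¬end , u∈D , λ (u≡d , _) → u≢d u≡d) , u~g))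

    module _ {F : V G → V H → Set} (F? : Decidable₂ F) (F⊆ : ∀ g h → F g h → Start g h)
             (dom : Dominates G H F) (irr : Irredundant G H F) where

      F⊆D : ∀ {g h} → ¬ End h → F g h → D g
      F⊆D ¬end f with F⊆ _ _ f
      ... | inj₁ (end , _)     = contradiction end ¬end
      ... | inj₂ (_ , g∈D , _) = g∈D

      d∉ends : ∀ {h} → End h → ¬ F d h
      d∉ends end f with F⊆ _ _ f
      ... | inj₁ (_ , inj₁ (_ , d≢d)) = d≢d refl
      ... | inj₁ (_ , inj₂ pr)        = proj₁ pr d∈D
      ... | inj₂ (¬end , _)           = ¬end end

      -- Nothing else in `Start` dominates (p , h): members of D other than d are not adjacent to p,
      -- epn(d) is independent, and the layers next to an end lie in D, which excludes p.
      private⊆ends : ∀ {p h} → End h → Private G D d p → F p h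
      private⊆ends {p} {h} end pr with dom p h
      ... | inj₁ f = f
      ... | inj₂ (inj₂ (x , f , x~h)) = contradiction (F⊆D (λ endx → end≁ endx end x~h) f) (proj₁ pr)
      ... | inj₂ (inj₁ (g , f , g~p)) with F⊆ _ _ f
      ...   | inj₁ (_ , inj₁ (g∈D , g≢d)) = contradiction (private-unique pr g∈D g~p) g≢d
      ...   | inj₁ (_ , inj₂ pr′)         = contradiction g~p (indep _ _ pr′ pr)
      ...   | inj₂ (¬end , _)             = contradiction end ¬end

      -- Over h, a private neighbour of g has no dominator in `F` but g: off the ends `F` lies in D,
      -- and over the ends the only vertices outside D are private to d, not to g.
      D∖d⊆F : ∀ {g h} → ¬ End h → D g → g ≢ d → F g h
      D∖d⊆F {g} {h} ¬end g∈D g≢d with private-neighbour g g∈D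
      ... | p , pr with dom p h
      ...   | inj₁ f = contradiction (F⊆D ¬end f) (proj₁ pr)
      ...   | inj₂ (inj₁ (u , f , u~p)) = subst (λ u → F u h) (private-unique pr (F⊆D ¬end f) u~p) f
      ...   | inj₂ (inj₂ (x , f , x~h)) with F⊆ _ _ f
      ...     | inj₁ (_ , inj₁ (p∈D , _)) = contradiction p∈D (proj₁ pr)
      ...     | inj₁ (_ , inj₂ pr′) = contradiction (private-unique pr′ g∈D (proj₁ (proj₂ pr))) g≢d
      ...     | inj₂ (_ , p∈D , _) = contradiction p∈D (proj₁ pr)

      Dropped : V H → V H → Set
      Dropped y h = (h H.~ y × ¬ End h × ¬ F d h) ⊎ h ≡ c

      dropped? : Decidable₂ Dropped
      dropped? y h = ((h H.~? y) ×-dec ¬? (end? h) ×-dec ¬? (F? d h)) ⊎-dec (h H.≟ c)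

      -- For y = a and y = b these are the sets F_a and F_b.
      Side : V H → V G → V H → Set
      Side y g h = (h ≡ y × F g h) ⊎ (h ≢ y × D g × ¬ (g ≡ d × Dropped y h))

      side? : ∀ y → Decidable₂ (Side y)
      side? y g h = ((h H.≟ y) ×-dec F? g h) ⊎-dec
                    (¬? (h H.≟ y) ×-dec member? g ×-dec ¬? ((g G.≟ d) ×-dec dropped? y h))

      module _ {y z} (y-end : End y) (z-end : End z) (z≢y : z ≢ y)
               (y~c : y H.~ c) (z~c : z H.~ c) where

        dropped~ : ∀ {h} → Dropped y h → y H.~ h
        dropped~ (inj₁ (h~y , _)) = H.~-sym h~y
        dropped~ (inj₂ refl)      = y~c

        dropped≢ : ∀ {h} → Dropped y h → h ≢ y
        dropped≢ dr h≡y = H.~-irrefl (sym h≡y) (dropped~ dr)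

        side-dominates : Dominates G H (Side y)
        side-dominates g h with h H.≟ y
        side-dominates g h | yes refl with dom g h
        ... | inj₁ f = inj₁ (inj₁ (refl , f))
        ... | inj₂ (inj₁ (u , f , u~g)) = inj₂ (inj₁ (u , inj₁ (refl , f) , u~g))
        -- `F` dominates (g , y) from a layer next to y, so g lies in D. Its copy over c takes over,
        -- unless g = d, which e dominates.
        ... | inj₂ (inj₂ (x , f , x~h)) with g G.≟ d
        ...   | yes refl = inj₂ (inj₁ (e , inj₁ (refl , private⊆ends y-end e-private) ,
                                       G.~-sym (proj₁ (proj₂ e-private))))
        ...   | no g≢d = inj₂ (inj₂ (c , inj₂ (dropped≢ (inj₂ refl) ,
                           F⊆D (λ endx → end≁ endx y-end x~h) f , λ (g≡d , _) → g≢d g≡d) , H.~-sym y~c))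
        side-dominates g h | no h≢y with dropped? y h
        ... | no ¬dr = case dominates g of λ
          { (inj₁ g∈D) → inj₁ (inj₂ (h≢y , g∈D , λ (_ , dr) → ¬dr dr))
          ; (inj₂ (u , u∈D , u~g)) → inj₂ (inj₁ (u , inj₂ (h≢y , u∈D , λ (_ , dr) → ¬dr dr) , u~g)) }
        ... | yes dr with member? g
        ...   | no g∉D = case private⊎shared d g∉D of λ
          { (inj₁ pr) → inj₂ (inj₂ (y , inj₁ (refl , private⊆ends y-end pr) , dropped~ dr))
          ; (inj₂ (u , (u∈D , u≢d) , u~g)) →
              inj₂ (inj₁ (u , inj₂ (h≢y , u∈D , λ (u≡d , _) → u≢d u≡d) , u~g)) }
        ...   | yes g∈D with g G.≟ d
        ...     | no g≢d = inj₁ (inj₂ (h≢y , g∈D , λ (g≡d , _) → g≢d g≡d))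
        ...     | yes refl with dr
        -- Over c, d is dominated from the other end z, where this set keeps all of D.
        ...       | inj₂ refl = inj₂ (inj₂ (z , inj₂ (z≢y , d∈D , λ
                      { (_ , inj₁ (_ , ¬end , _)) → ¬end z-end
                      ; (_ , inj₂ z≡c) → H.~-irrefl z≡c z~c }) , z~c))
        ...       | inj₁ (h~y , ¬end , ¬f) with dom g h
        ...         | inj₁ f = contradiction f ¬f
        ...         | inj₂ (inj₁ (u , f , u~d)) = inj₂ (inj₁ (u , inj₂ (h≢y , F⊆D ¬end f ,
                        λ (u≡d , _) → G.~-irrefl u≡d u~d) , u~d))
        ...         | inj₂ (inj₂ (x , f , x~h)) with F⊆ _ _ f
        ...           | inj₁ (endx , _) = contradiction f (d∉ends endx)
        -- Since `F` contains (d , x), the layer x could only be dropped if x = c. But then h is a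
        -- third neighbour of c, and `Start` omits (d , c).
        ...           | inj₂ (¬endx , _ , ¬start) = inj₂ (inj₂ (x , inj₂
                          ( (λ { refl → ¬endx y-end }) , d∈D , λ
                            { (_ , inj₁ (_ , _ , ¬f′)) → ¬f′ f
                            ; (_ , inj₂ refl) → ¬start (refl , refl , h , H.~-sym x~h , ¬end) }) , x~h))

      layer : ∀ {F : V G → V H → Set} → Decidable₂ F → V H → ℕ
      layer F? h = # G λ g → F? g h

      #D : ℕ
      #D = # G member?

      at-end : ∀ {y} → layer (side? y) y ≤ layer F? y
      at-end = #-mono G _ _ λ
        { _ (inj₁ (_ , f)) → f ; _ (inj₂ (y≢y , _)) → contradiction refl y≢y }

      off-end : ∀ {y h} → h ≢ y → layer (side? y) h ≤ #D
      off-end h≢y = #-mono G _ _ λ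
        { _ (inj₁ (h≡y , _)) → contradiction h≡y h≢y ; _ (inj₂ (_ , g∈D , _)) → g∈D }

      dropped : ∀ {y h} → End y → ¬ End h → Dropped y h → layer (side? y) h ≤ layer F? h
      dropped y-end ¬end dr = #-mono G _ _ λ
        { _ (inj₁ (refl , _)) → contradiction y-end ¬end
        ; g (inj₂ (_ , g∈D , ¬dr)) → D∖d⊆F ¬end g∈D λ g≡d → ¬dr (g≡d , dr) }

      D⊆layer : ∀ {h} → ¬ End h → F d h → #D ≤ layer F? h
      D⊆layer {h} ¬end f = #-mono G _ _ λ g g∈D → case g G.≟ d of λ
        { (yes refl) → f ; (no g≢d) → D∖d⊆F ¬end g∈D g≢d }

      dropped< : ∀ {y h} → h ≢ y → Dropped y h → layer (side? y) h < #D
      dropped< h≢y dr = #-mono-< G _ member? (λ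
        { _ (inj₁ (h≡y , _)) → contradiction h≡y h≢y ; _ (inj₂ (_ , g∈D , _)) → g∈D })
        {d} (λ { (inj₁ (h≡y , _)) → contradiction h≡y h≢y ; (inj₂ (_ , _ , ¬dr)) → ¬dr (refl , dr) }) d∈D

      -- `F` contains copies of e only over the ends, and within the layer of h only d could
      -- dominate e.
      missing⇒near-end : ∀ {h} → ¬ End h → ¬ F d h → h H.~ a ⊎ h H.~ b
      missing⇒near-end {h} ¬end ¬f with dom e h
      ... | inj₁ f = contradiction (F⊆D ¬end f) (proj₁ e-private)
      ... | inj₂ (inj₁ (u , f , u~e)) = contradiction
              (subst (λ u → F u h) (private-unique e-private (F⊆D ¬end f) u~e) f) ¬f
      ... | inj₂ (inj₂ (x , f , x~h)) with end? x
      ...   | yes (inj₁ refl) = inj₁ (H.~-sym x~h)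
      ...   | yes (inj₂ refl) = inj₂ (H.~-sym x~h)
      ...   | no ¬endx = contradiction (F⊆D ¬endx f) (proj₁ e-private)

      -- Off the ends, a layer of `F` with d contains D. A layer without d is next to a or b, and
      -- the set on that side omits d there too.
      layer-≤ : ∀ h → layer (side? a) h + layer (side? b) h ≤ layer F? h + #D
      layer-≤ h = bound (end? h) (F? d h)
        where
        bound : Dec (End h) → Dec (F d h) → layer (side? a) h + layer (side? b) h ≤ layer F? h + #D
        bound (yes (inj₁ refl)) _ = +-mono-≤ at-end (off-end a≢b)
        bound (yes (inj₂ refl)) _ =
          ≤-trans (+-mono-≤ (off-end (a≢b ∘ sym)) at-end) (≤-reflexive (+-comm #D _))
        bound (no ¬end) (yes f) =
          +-mono-≤ (≤-trans (off-end (¬end ∘ inj₁)) (D⊆layer ¬end f)) (off-end (¬end ∘ inj₂))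
        bound (no ¬end) (no ¬f) with missing⇒near-end ¬end ¬f
        ... | inj₁ h~a = +-mono-≤ (dropped (inj₁ refl) ¬end (inj₁ (h~a , ¬end , ¬f))) (off-end (¬end ∘ inj₂))
        ... | inj₂ h~b = ≤-trans
                (+-mono-≤ (off-end (¬end ∘ inj₁)) (dropped (inj₂ refl) ¬end (inj₁ (h~b , ¬end , ¬f))))
                (≤-reflexive (+-comm #D _))

      -- Over c both sets omit d: one omission allows for `F` possibly lacking (d , c), the other is
      -- gained.
      layer-<-c : layer (side? a) c + layer (side? b) c < layer F? c + #D
      layer-<-c = +-mono-≤-< (dropped (inj₁ refl) c-not-end (inj₂ refl))
                             (dropped< (c-not-end ∘ inj₂) (inj₂ refl))

      no-minimal-subset : ⊥
      no-minimal-subset = <⇒≱ (begin-strict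
        ## G H (side? a) + ## G H (side? b)                    ≡⟨ ∑-distrib-+ {H.order} _ _ ⟨
        sumOver H (λ h → layer (side? a) h + layer (side? b) h) <⟨ sumOver-mono-< H layer-≤ c layer-<-c ⟩
        sumOver H (λ h → layer F? h + #D)                      ≡⟨ ∑-distrib-+ {H.order} _ _ ⟩
        ## G H F? + ## G H everywhere?                         ∎)
        (+-mono-≤ (minimum F? (side? a) dom irr
                     (side-dominates (inj₁ refl) (inj₂ refl) (a≢b ∘ sym) a~c b~c))
                  (minimum everywhere? (side? b) everywhere-dominates everywhere-irredundant
                     (side-dominates (inj₂ refl) (inj₁ refl) a≢b b~c a~c)))
        where open ≤-Reasoning

    no-induced-path : ⊥
    no-induced-path = minimalSubset G H start? start-dominates no-minimal-subset

-- Connected graphs forced to be complete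

connected∧transitive⇒complete : ∀ X → let open Graph X in
  Connected X → (∀ {a b c} → a ~ c → c ~ b → a ≢ b → a ~ b) → Complete X
connected∧transitive⇒complete X connected ~-trans u v = go (connected u v)
  where
  open Graph X using (_~_; _≟_)
  go : ∀ {u v} → Star _~_ u v → u ≢ v → u ~ v
  go ε u≢u = contradiction refl u≢u
  go {v = v} (_◅_ {j = w} u~w w⋆v) u≢v with w ≟ v
  ... | yes refl = u~w
  ... | no w≢v   = ~-trans u~w (go w⋆v w≢v) u≢v

degree : ∀ X → V X → ℕ
degree X v = # X λ u → Graph._~?_ X u v

-- A neighbour of d is already adjacent to the deg(d) other vertices of N[d], so an edge leaving
-- N[d] would exceed the maximum degree; connectedness then makes N[d] the whole graph.
clique-of-maximum-degree⇒complete : ∀ X d → let open Graph X in Connected X →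
  (∀ {u v} → u ~ d → v ~ d → u ≢ v → u ~ v) → (∀ v → degree X v ≤ degree X d) → Complete X
clique-of-maximum-degree⇒complete X d connected clique max u v u≢v =
  adjacent (reach (inj₁ refl) (connected d u)) (reach (inj₁ refl) (connected d v))
  where
  open Graph X hiding (V)

  Closed : V X → Set
  Closed x = x ≡ d ⊎ x ~ d

  closed? : Decidable Closed
  closed? x = (x ≟ d) ⊎-dec (x ~? d)

  #closed : # X closed? ≡ suc (degree X d)
  #closed = #-remove X closed? (_~? d) d (inj₁ refl) (~-irrefl refl)
    (λ { _ u≢d (inj₁ u≡d) → contradiction u≡d u≢d ; _ _ (inj₂ u~d) → u~d }) (λ _ → inj₂)

  no-exit : ∀ {v x} → v ~ d → x ~ v → Closed x
  no-exit {v} {x} v~d x~v = decidable-stable (closed? x) λ ¬closed → <⇒≱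
    (#-mono-< X (_∖?_ X closed? v) (_~? v)
      (λ { _ (inj₁ refl , _) → ~-sym v~d ; _ (inj₂ u~d , u≢v) → clique u~d v~d u≢v })
      (¬closed ∘ proj₁) x~v)
    (≤-trans (max v) (≤-reflexive (suc-injective (trans (sym #closed) (#-∖ X closed? (inj₂ v~d))))))

  reach : ∀ {u v} → Closed u → Star _~_ u v → Closed v
  reach u∈ ε = u∈
  reach (inj₁ refl) (u~w ◅ w⋆v) = reach (inj₂ (~-sym u~w)) w⋆v
  reach (inj₂ u~d)  (u~w ◅ w⋆v) = reach (no-exit u~d (~-sym u~w)) w⋆v

  adjacent : Closed u → Closed v → u ~ v
  adjacent (inj₁ refl) (inj₁ refl) = contradiction refl u≢v
  adjacent (inj₁ refl) (inj₂ v~d)  = ~-sym v~d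
  adjacent (inj₂ u~d)  (inj₁ refl) = u~d
  adjacent (inj₂ u~d)  (inj₂ v~d)  = clique u~d v~d u≢v

-- Dependent private neighbours and colourings

module _ (G H : Graph) (minimum : MinimalIsMinimum G H)
  {D : V G → Set} (good : PrivatelyDominating G D) where
  private
    module G = Graph G
    module H = Graph H
  open PrivatelyDominating good

  privateIndependent⇒complete : Connected H → ∀ {d} → D d → PrivateIndependent G D d → Complete H
  privateIndependent⇒complete connected d∈D indep = connected∧transitive⇒complete H connected
    λ {a} {b} a~c c~b a≢b → decidable-stable (a H.~? b) λ a≁b →
      InducedPath.no-induced-path G H minimum good a~c (H.~-sym c~b) a≢b a≁b d∈D indep

  module _ (dependent : ∀ {d} → D d → ¬ PrivateIndependent G D d) where

    -- A copy of D may be exchanged for S without losing minimality, because an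
    -- independent set never contains all the private neighbours of a member of D.
    module _ {w k} (k~w : k H.~ w) {S : V G → Set} (S? : Decidable S)
      (outside : ∀ {v} → S v → ¬ D v) (indep : ∀ {u v} → S u → S v → ¬ u G.~ v)
      (maximal : ∀ {v} → ¬ D v → S v ⊎ (∃[ s ] S s × s G.~ v)) where

      private
        Exchanged : V G → V H → Set
        Exchanged g h = (h ≡ w × S g) ⊎ (h ≢ w × D g)

        exchanged? : Decidable₂ Exchanged
        exchanged? g h = ((h H.≟ w) ×-dec S? g) ⊎-dec (¬? (h H.≟ w) ×-dec member? g)

        exchanged-dominates : Dominates G H Exchanged
        exchanged-dominates g h with h H.≟ w
        ... | no h≢w = case dominates g of λ
          { (inj₁ g∈D) → inj₁ (inj₂ (h≢w , g∈D))
          ; (inj₂ (u , u∈D , u~g)) → inj₂ (inj₁ (u , inj₂ (h≢w , u∈D) , u~g)) }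
        ... | yes refl with member? g
        -- Members of D over w may have no neighbour in S; their copies over k dominate them.
        ...   | yes g∈D = inj₂ (inj₂ (k , inj₂ ((λ k≡w → H.~-irrefl k≡w k~w) , g∈D) , k~w))
        ...   | no g∉D with maximal g∉D
        ...     | inj₁ g∈S = inj₁ (inj₁ (refl , g∈S))
        ...     | inj₂ (s , s∈S , s~g) = inj₂ (inj₁ (s , inj₁ (refl , s∈S) , s~g))

        exchanged-irredundant : Irredundant G H Exchanged
        exchanged-irredundant s h (inj₁ (refl , s∈S)) dom with dom s h
        ... | inj₁ (_ , ne) = ne (refl , refl)
        ... | inj₂ (inj₁ (t , (inj₁ (_ , t∈S) , _) , t~s)) = indep t∈S s∈S t~s
        ... | inj₂ (inj₁ (_ , (inj₂ (h≢h , _) , _) , _)) = h≢h refl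
        ... | inj₂ (inj₂ (x , (inj₁ (refl , _) , _) , x~h)) = H.~-irrefl refl x~h
        ... | inj₂ (inj₂ (x , (inj₂ (_ , s∈D) , _) , _)) = outside s∈S s∈D
        exchanged-irredundant d h (inj₂ (h≢w , d∈D)) dom =
          -- If (d , h) were redundant, every private neighbour of d over h would be dominated from
          -- the layer of w and hence lie in S.
          dependent d∈D λ _ _ pr pr′ → indep (private⊆S pr) (private⊆S pr′)
          where
          private⊆S : ∀ {p} → Private G D d p → S p
          private⊆S {p} pr with dom p h
          ... | inj₁ (inj₁ (h≡w , _) , _) = contradiction h≡w h≢w
          ... | inj₁ (inj₂ (_ , p∈D) , _) = contradiction p∈D (proj₁ pr)
          ... | inj₂ (inj₁ (_ , (inj₁ (h≡w , _) , _) , _)) = contradiction h≡w h≢w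
          ... | inj₂ (inj₁ (u , (inj₂ (_ , u∈D) , ne) , u~p)) =
                  contradiction (private-unique pr u∈D u~p , refl) ne
          ... | inj₂ (inj₂ (_ , (inj₁ (_ , p∈S) , _) , _)) = p∈S
          ... | inj₂ (inj₂ (_ , (inj₂ (_ , p∈D) , _) , _)) = contradiction p∈D (proj₁ pr)

      -- The exchanged set is minimal, hence no larger than D × V(H), from which it differs only
      -- over w.
      maximal-independent-≤ : # G S? ≤ # G member?
      maximal-independent-≤ = ≮⇒≥ λ D<S → <⇒≱
        (sumOver-mono-< H (λ h → layer-≥ (<⇒≤ D<S) (h H.≟ w)) w (<-≤-trans D<S S≤layer))
        (minimum exchanged? (everywhere? G H minimum good) exchanged-dominates
                 exchanged-irredundant (everywhere-dominates G H minimum good))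
        where
        S≤layer : # G S? ≤ # G (λ g → exchanged? g w)
        S≤layer = #-mono G S? _ λ _ g∈S → inj₁ (refl , g∈S)
        layer-≥ : # G member? ≤ # G S? → ∀ {h} → Dec (h ≡ w) → # G member? ≤ # G (λ g → exchanged? g h)
        layer-≥ D≤S (yes refl) = ≤-trans D≤S S≤layer
        layer-≥ D≤S (no h≢w)   = #-mono G member? _ λ _ g∈D → inj₂ (h≢w , g∈D)

    module Colouring {d h w} (d∈D : D d) (w~h : w H.~ h) (colour : V G → V H)
      (colour~h : ∀ {p} → Private G D d p → colour p H.~ h)
      (colour≢w : ∀ {p} → Private G D d p → colour p ≢ w)
      (proper : ∀ {p q} → Private G D d p → Private G D d q → colour p ≡ colour q → ¬ p G.~ q) where

      record Layered (S : V G → V H → Set) : Set where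
        field
          outside : ∀ {v x} → S v x → ¬ D v
          indep   : ∀ {u v x} → S u x → S v x → ¬ u G.~ v
          covers  : ∀ {p} → Private G D d p → S p (colour p)

      colourClasses? : Decidable₂ λ p x → Private G D d p × colour p ≡ x
      colourClasses? p x = private? d p ×-dec (colour p H.≟ x)

      colourClasses-layered : Layered λ p x → Private G D d p × colour p ≡ x
      colourClasses-layered = record
        { outside = λ (pr , _) → proj₁ pr
        ; indep   = λ { (pr , refl) (pr′ , eq) → proper pr pr′ (sym eq) }
        ; covers  = λ pr → pr , refl
        }

      module _ {S : V G → V H → Set} (S? : Decidable₂ S) (layered : Layered S)
        (maximal : ∀ {x v} → ¬ D v → S v x ⊎ (∃[ s ] S s x × s G.~ v)) where
        open Layered layered

        Used : V H → Set
        Used x = ∃[ p ] Private G D d p × colour p ≡ x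

        used? : Decidable Used
        used? x = ∃? G λ p → colourClasses? p x

        used~h : ∀ {x} → Used x → x H.~ h
        used~h (_ , pr , refl) = colour~h pr

        Layers : V G → V H → Set
        Layers g x = (x ≡ h × D g × g ≢ d) ⊎ (x ≢ h × ((Used x × S g x) ⊎ (¬ Used x × D g)))

        layers? : Decidable₂ Layers
        layers? g x = ((x H.≟ h) ×-dec member? g ×-dec ¬? (g G.≟ d)) ⊎-dec
          (¬? (x H.≟ h) ×-dec ((used? x ×-dec S? g x) ⊎-dec (¬? (used? x) ×-dec member? g)))

        layers-dominates : Dominates G H Layers
        layers-dominates g x with x H.≟ h
        layers-dominates g x | yes refl with member? g
        ... | yes g∈D = case g G.≟ d of λ
          { (no g≢d) → inj₁ (inj₁ (refl , g∈D , g≢d))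
          ; (yes refl) → inj₂ (inj₂ (w , inj₂ ((λ w≡h → H.~-irrefl w≡h w~h) ,
              inj₂ ((λ (_ , pr , eq) → colour≢w pr eq) , d∈D)) , w~h)) }
        ... | no g∉D = case private⊎shared d g∉D of λ
          { (inj₁ pr) → inj₂ (inj₂ (colour g , inj₂ ((λ eq → H.~-irrefl eq (colour~h pr)) ,
              inj₁ ((g , pr , refl) , covers pr)) , colour~h pr))
          ; (inj₂ (u , u∈ , u~g)) → inj₂ (inj₁ (u , inj₁ (refl , u∈) , u~g)) }
        layers-dominates g x | no x≢h with used? x
        ... | no ¬used = case dominates g of λ
          { (inj₁ g∈D) → inj₁ (inj₂ (x≢h , inj₂ (¬used , g∈D)))
          ; (inj₂ (u , u∈D , u~g)) → inj₂ (inj₁ (u , inj₂ (x≢h , inj₂ (¬used , u∈D)) , u~g)) }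
        ... | yes used with member? g
        ...   | no g∉D = case maximal g∉D of λ
          { (inj₁ g∈S) → inj₁ (inj₂ (x≢h , inj₁ (used , g∈S)))
          ; (inj₂ (s , s∈S , s~g)) → inj₂ (inj₁ (s , inj₂ (x≢h , inj₁ (used , s∈S)) , s~g)) }
        ...   | yes g∈D with g G.≟ d
        ...     | no g≢d = inj₂ (inj₂ (h , inj₁ (refl , g∈D , g≢d) , H.~-sym (used~h used)))
        ...     | yes refl with used
        -- The layer of h lacks d, but the colour is used, so some private neighbour of d lies in S
        -- over this layer and dominates d.
        ...       | p , pr , refl = inj₂ (inj₁ (p , inj₂ (x≢h , inj₁ ((p , pr , refl) , covers pr)) ,
                                               G.~-sym (proj₁ (proj₂ pr))))

        layer-≤ : ∀ {x} → Dec (x ≡ h) → Dec (Used x) → # G (λ g → layers? g x) ≤ # G member?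
        layer-≤ (yes refl) _ = #-mono G _ _ λ
          { _ (inj₁ (_ , g∈D , _)) → g∈D ; _ (inj₂ (h≢h , _)) → contradiction refl h≢h }
        layer-≤ (no x≢h) (no ¬used) = #-mono G _ _ λ
          { _ (inj₁ (x≡h , _)) → contradiction x≡h x≢h
          ; _ (inj₂ (_ , inj₁ (used , _))) → contradiction used ¬used
          ; _ (inj₂ (_ , inj₂ (_ , g∈D))) → g∈D }
        layer-≤ {x} (no x≢h) (yes used) = ≤-trans
          (#-mono G _ (λ g → S? g x) λ
            { _ (inj₁ (x≡h , _)) → contradiction x≡h x≢h
            ; _ (inj₂ (_ , inj₁ (_ , g∈S))) → g∈S
            ; _ (inj₂ (_ , inj₂ (¬used , _))) → contradiction used ¬used })
          (maximal-independent-≤ (H.~-sym (used~h used)) (λ g → S? g x) outside indep maximal)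

        layers-too-small : ⊥
        layers-too-small = <⇒≱
          (sumOver-mono-< H (λ x → layer-≤ (x H.≟ h) (used? x)) h
            (#-mono-< G (λ g → layers? g h) member?
              (λ { _ (inj₁ (_ , g∈D , _)) → g∈D ; _ (inj₂ (h≢h , _)) → contradiction refl h≢h })
              {d} (λ { (inj₁ (_ , _ , d≢d)) → d≢d refl ; (inj₂ (h≢h , _)) → h≢h refl }) d∈D))
          (minimum (everywhere? G H minimum good) layers? (everywhere-dominates G H minimum good)
                   (everywhere-irredundant G H minimum good) layers-dominates)

      complement? : ∀ {S : V G → V H → Set} → Decidable₂ S → Decidable₂ λ g x → ¬ S g x
      complement? S? g x = ¬? (S? g x)

      -- All layers are enlarged at once: a `Layered` family with smallest complement is maximal in
      -- every layer, since a free vertex could otherwise be added to one of them.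
      no-colouring : ⊥
      no-colouring = least {A = ∃ Decidable₂} {P = λ (S , _) → Layered S}
        (λ (_ , S?) → ## G H (complement? S?)) {_ , colourClasses?} colourClasses-layered
        λ { {S , S?} layered fewest → layers-too-small S? layered λ {x} {v} v∉D →
          case S? v x ⊎-dec ∃? G (λ s → S? s x ×-dec (s G.~? v)) of λ
          { (yes y) → y
          ; (no free) → contradiction
              (fewest {_ , λ g y → S? g y ⊎-dec ((g G.≟ v) ×-dec (y H.≟ x))} (extend layered v∉D free))
              (<⇒≱ (##-mono-< G H (complement? λ g y → S? g y ⊎-dec ((g G.≟ v) ×-dec (y H.≟ x)))
                     (complement? S?) (λ _ _ ¬s s → ¬s (inj₁ s))
                     (λ ¬s → ¬s (inj₂ (refl , refl))) (free ∘ inj₁))) } }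
        where
        extend : ∀ {S v x} → Layered S → ¬ D v → ¬ (S v x ⊎ (∃[ s ] S s x × s G.~ v)) →
                 Layered λ g y → S g y ⊎ (g ≡ v × y ≡ x)
        extend layered v∉D free = record
          { outside = λ { (inj₁ s) → outside s ; (inj₂ (refl , _)) → v∉D }
          ; indep   = λ { (inj₁ s) (inj₁ t) → indep s t
                        ; (inj₁ s) (inj₂ (refl , refl)) s~v → free (inj₂ (_ , s , s~v))
                        ; (inj₂ (refl , refl)) (inj₁ s) v~s → free (inj₂ (_ , s , G.~-sym v~s))
                        ; (inj₂ (refl , _)) (inj₂ (refl , _)) → G.~-irrefl refl }
          ; covers  = inj₁ ∘ covers
          }
          where open Layered layered

    maximum-degree⇒complete : Connected G → ∀ {d h} → D d → (∀ g → degree G g ≤ degree H h) → Complete G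
    maximum-degree⇒complete connected {d} {h} d∈D max = complete
      where
      private≤deg : # G (private? d) ≤ degree G d
      private≤deg = #-mono G (private? d) (G._~? d) λ _ (_ , d~p , _) → G.~-sym d~p

      no-nonadjacent : ∀ {p q} → Private G D d p → Private G D d q → p ≢ q → ¬ p G.~ q → ⊥
      no-nonadjacent {p} {q} pr-p pr-q p≢q p≁q = Colouring.no-colouring d∈D I.missed∈
          (I.fun ∘ merge) (I.into ∘ merge∈) (I.misses ∘ merge∈)
          (λ pr pr′ eq → merge-proper (I.injective (merge∈ pr) (merge∈ pr′) eq))
        where
        A? = _∖?_ G (private? d) q
        module I = StrictInjection (strictInjection G H A? (H._~? h)
          (≤-trans (≤-reflexive (sym (#-∖ G (private? d) pr-q))) (≤-trans private≤deg (max d))))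
        merge : V G → V G
        merge x with x G.≟ q
        ... | yes _ = p
        ... | no _  = x
        merge∈ : ∀ {x} → Private G D d x → Private G D d (merge x) × merge x ≢ q
        merge∈ {x} pr with x G.≟ q
        ... | yes _  = pr-p , p≢q
        ... | no x≢q = pr , x≢q
        merge-proper : ∀ {x y} → merge x ≡ merge y → ¬ x G.~ y
        merge-proper {x} {y} eq x~y with x G.≟ q | y G.≟ q
        ... | yes refl | yes refl = G.~-irrefl refl x~y
        ... | yes refl | no _     = p≁q (subst (G._~ q) (sym eq) (G.~-sym x~y))
        ... | no _     | yes refl = p≁q (subst (G._~ q) eq x~y)
        ... | no _     | no _     = G.~-irrefl eq x~y

      deg≤private : degree H h ≤ # G (private? d)
      deg≤private = ≮⇒≥ λ lt → let module I = StrictInjection (strictInjection G H (private? d) (H._~? h) lt)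
        in Colouring.no-colouring d∈D I.missed∈ I.fun I.into I.misses
             (λ pr pr′ eq → G.~-irrefl (I.injective pr pr′ eq))

      -- epn(d) is contained in N(d), and deg(d) ≤ deg(h) ≤ |epn(d)| forces equality.
      neighbour-private : ∀ {u} → u G.~ d → Private G D d u
      neighbour-private {u} u~d = decidable-stable (private? d u) λ ¬pr → <⇒≱
        (#-mono-< G (private? d) (G._~? d) (λ _ (_ , d~p , _) → G.~-sym d~p) ¬pr u~d)
        (≤-trans (max d) deg≤private)

      complete : Complete G
      complete = clique-of-maximum-degree⇒complete G d connected
        (λ {u} {v} u~d v~d u≢v → decidable-stable (u G.~? v)
          (no-nonadjacent (neighbour-private u~d) (neighbour-private v~d) u≢v))
        (λ v → ≤-trans (max v) (≤-trans deg≤private private≤deg))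

-- Choosing the factor of larger degree and conclusion

-- An isolated vertex of a connected graph is its only vertex, and the one-vertex graph is complete.
no-isolated-vertex : ∀ X → let open Graph X in
  Connected X → ¬ Complete X → ∀ v → ∃[ u ] u ~ v
no-isolated-vertex X connected ¬complete v = decidable-stable (∃? X (_~? v)) λ isolated →
  ¬complete λ u w u≢w → contradiction
    (trans (sym (stuck isolated (connected v u))) (stuck isolated (connected v w))) u≢w
  where
  open Graph X hiding (V)
  stuck : ∀ {u} → ¬ (∃[ x ] x ~ v) → Star _~_ v u → v ≡ u
  stuck _        ε         = refl
  stuck isolated (v~x ◅ _) = contradiction (_ , ~-sym v~x) isolated

larger-degree-contradiction : ∀ G H → MinimalIsMinimum G H → Connected G → Connected H →
  ¬ Complete G → ¬ Complete H → ∀ {h} → (∀ g → degree G g ≤ degree H h) → ⊥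
larger-degree-contradiction G H minimum connG connH ¬compG ¬compH max =
  privatelyDominating G (no-isolated-vertex G connG ¬compG) λ good →
    let dependent = λ {d} d∈D indep →
          ¬compH (privateIndependent⇒complete G H minimum good connH {d} d∈D indep)
        finish = λ {d} d∈D → ¬compG (maximum-degree⇒complete G H minimum good dependent connG {d} d∈D max)
    -- D has a member because it dominates the vertex that every graph carries.
    in case PrivatelyDominating.dominates good (Graph.vertex G) of λ
       { (inj₁ d∈D) → finish d∈D ; (inj₂ (_ , d∈D , _)) → finish d∈D }

-- A vertex of largest degree in the disjoint union lies in one of the factors. `least` minimises,
-- hence the measure `bound ∸ deg`, which reverses the order because no degree exceeds `bound`.
maximum-degree : ∀ G H →
  (∀ {g} → (∀ h → degree H h ≤ degree G g) → ⊥) →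
  (∀ {h} → (∀ g → degree G g ≤ degree H h) → ⊥) → ⊥
maximum-degree G H inG inH = least {P = λ _ → ⊤} (λ x → bound ∸ deg x) {inj₁ (Graph.vertex G)} _ λ
  { {inj₁ g} _ min → inG λ h → ∸-cancelʳ-≤ (deg≤bound (inj₂ h)) (min {inj₂ h} _)
  ; {inj₂ h} _ min → inH λ g → ∸-cancelʳ-≤ (deg≤bound (inj₁ g)) (min {inj₁ g} _) }
  where
  deg : V G ⊎ V H → ℕ
  deg (inj₁ g) = degree G g
  deg (inj₂ h) = degree H h
  bound = # G {P = λ _ → ⊤} (λ _ → yes _) + # H {P = λ _ → ⊤} (λ _ → yes _)
  deg≤bound : ∀ x → deg x ≤ bound
  deg≤bound (inj₁ g) = m≤n⇒m≤n+o _ (#-mono G _ _ _)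
  deg≤bound (inj₂ h) = m≤n⇒m≤o+n _ (#-mono H _ _ _)

module _ (G H : Graph) (connected : Connected (G □ H)) where
  private
    module G = Graph G
    module H = Graph H

  connectedˡ : Connected G
  connectedˡ u v = project (connected (u , H.vertex) (v , H.vertex))
    where
    project : ∀ {x y} → Star (Graph._~_ (G □ H)) x y → Star G._~_ (proj₁ x) (proj₁ y)
    project ε = ε
    project (inj₁ (refl , _) ◅ p) = project p
    project (inj₂ (e , _) ◅ p)    = e ◅ project p

  connectedʳ : Connected H
  connectedʳ u v = project (connected (G.vertex , u) (G.vertex , v))
    where
    project : ∀ {x y} → Star (Graph._~_ (G □ H)) x y → Star H._~_ (proj₂ x) (proj₂ y)
    project ε = ε
    project (inj₁ (_ , e) ◅ p)    = e ◅ project p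
    project (inj₂ (_ , refl) ◅ p) = project p

-- The argument only refutes that both factors are incomplete; decidability turns this into the
-- disjunction.
complete? : ∀ X → Dec (Complete X)
complete? X = map′
  (λ none u v u≢v → decidable-stable (u ~? v) λ u≁v → none (u , v , u≢v , u≁v))
  (λ complete (u , v , u≢v , u≁v) → u≁v (complete u v u≢v))
  (¬? (∃? X λ u → ∃? X λ v → ¬? (u ≟ v) ×-dec ¬? (u ~? v)))
  where open Graph X

theorem4 : (G H : Graph) → Connected (G □ H) → WellDominated (G □ H) → Complete G ⊎ Complete H
theorem4 G H connected well-dominated = decidable-stable (complete? G ⊎-dec complete? H) λ neither →
  maximum-degree G H
    (larger-degree-contradiction H G (MinimalIsMinimum-sym G H minimum) connH connG
      (neither ∘ inj₂) (neither ∘ inj₁))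
    (larger-degree-contradiction G H minimum connG connH (neither ∘ inj₁) (neither ∘ inj₂))
  where
  minimum = wellDominated⇒minimalIsMinimum G H well-dominated
  connG = connectedˡ G H connected
  connH = connectedʳ G H connected
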